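{- Let $t\in\mathcal T_\lambda$. Then $t$ is $\mathcal V$-typable if and only if $t$ is $\mathtt v$-normalising. Moreover, if $\Phi$ is a derivation of $\Gamma\vdash t:\tau$ in system $\mathcal V$, then there exist $p\in\mathsf{no}_{\mathtt v}$ and natural numbers $b,e$ such that $t\twoheadrightarrow_{\mathtt v}^{(b,e)}p$ and $\mathtt{sz}_{\mathtt v}(\Phi)\ge b+e+|p|_{\mathtt v}$.
   Context: Terms $\mathcal T_\lambda$: $t,u ::= v\mid t\,u\mid t[x\backslash u]$, with values $v ::= x\mid\lambda x.t$. Here $[x\backslash u]$ is a syntactic explicit substitution; $\lambda x.t$ and $t[x\backslash u]$ bind $x$ in $t$; terms are modulo $\alpha$-conversion; $t\{x\backslash u\}$ is capture-avoiding meta-level substitution. List contexts: $L ::= \Box\mid L[x\backslash t]$. Call-by-Value contexts: $V ::= \Box\mid V\,t\mid t\,V\mid V[x\backslash u]\mid t[x\backslash V]$. Rules (avoiding capture): $\mathtt{dB}$: $L\langle\lambda x.t\rangle\,u\mapsto L\langle t[x\backslash u]\rangle$; $\mathtt{sv}$: $t[x\backslash L\langle v\rangle]\mapsto L\langle t\{x\backslash v\}\rangle$ ($v$ a value). $\to_{\mathtt v}$ is the closure of $\mathtt{dB}$ and $\mathtt{sv}$ under contexts $V$; $t\twoheadrightarrow_{\mathtt v}^{(b,e)}u$ means $t$ $\to_{\mathtt v}$-reduces to $u$ with exactly $b$ $\mathtt{dB}$-steps and $e$ $\mathtt{sv}$-steps. $t$ is $\mathtt v$-normalising if it $\to_{\mathtt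 v}$-reduces (in finitely many steps) to a term with no $\to_{\mathtt v}$-reduct. Normal forms: $\mathsf{vr}_{\mathtt v} ::= x\mid\mathsf{vr}_{\mathtt v}[x\backslash\mathsf{ne}_{\mathtt v}]$; $\mathsf{ne}_{\mathtt v} ::= \mathsf{vr}_{\mathtt v}\,\mathsf{no}_{\mathtt v}\mid\mathsf{ne}_{\mathtt v}\,\mathsf{no}_{\mathtt v}\mid\mathsf{ne}_{\mathtt v}[x\backslash\mathsf{ne}_{\mathtt v}]$; $\mathsf{no}_{\mathtt v} ::= \lambda x.t\mid\mathsf{vr}_{\mathtt v}\mid\mathsf{ne}_{\mathtt v}\mid\mathsf{no}_{\mathtt v}[x\backslash\mathsf{ne}_{\mathtt v}]$ ($t$ any term). Size of terms: $|x|_{\mathtt v}=0$, $|\lambda x.t|_{\mathtt v}=0$, $|t\,u|_{\mathtt v}=1+|t|_{\mathtt v}+|u|_{\mathtt v}$, $|t[x\backslash u]|_{\mathtt v}=1+|t|_{\mathtt v}+|u|_{\mathtt v}$. Types: $\sigma,\tau ::= \alpha \mid M \mid M\to\sigma$, $\alpha$ in a countably infinite set of base types, $M ::= [\sigma_i]_{i\in I}$ a finite (possibly empty) multiset of types, $|M|$ its cardinality. Typing contexts map variables to multiset types, all but finitely many to the empty multiset $[\,]$; $+$ is pointwise multiset union; $\Gamma\setminus\!\!\setminus x$ maps $x$ to $[\,]$ and agrees with $\Gamma$ elsewhere; $x:M$ maps $x$ to $M$ and all others to $[\,]$. System $\mathcal V$ ($I$ finite, possibly empty): $(\mathrm{ax}_v)$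 $x:M\vdash x:M$; $(\mathrm{es}_v)$ from $\Gamma\vdash t:\sigma$ and $\Delta\vdash u:\Gamma(x)$ infer $(\Gamma\setminus\!\!\setminus x)+\Delta\vdash t[x\backslash u]:\sigma$; $(\mathrm{abs}_v)$ from $(\Gamma_i\vdash t:\tau_i)_{i\in I}$ infer $+_{i\in I}(\Gamma_i\setminus\!\!\setminus x)\vdash\lambda x.t:[\Gamma_i(x)\to\tau_i]_{i\in I}$; $(\mathrm{app}_v)$ from $\Gamma\vdash t:[M\to\tau]$ and $\Delta\vdash u:M$ infer $\Gamma+\Delta\vdash t\,u:\tau$. $t$ is $\mathcal V$-typable if some $\Gamma\vdash t:\sigma$ is derivable. Size of derivations: $\mathtt{sz}_{\mathtt v}$ of an axiom $x:M\vdash x:M$ is $|M|$; of a derivation ending with $(\mathrm{es}_v)$ or $(\mathrm{app}_v)$ it is $1$ plus the sizes of the two premise derivations; of a derivation ending with $(\mathrm{abs}_v)$ with premise derivations $(\Pi_i)_{i\in I}$ it is $|I|+\sum_{i\in I}\mathtt{sz}_{\mathtt v}(\Pi_i)$. -}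

module Defs where

open import Data.Fin.Base using (Fin; zero; suc)
open import Data.List.Base using (List; []; _∷_; _++_; length)
import Data.List.Relation.Binary.Permutation.Homogeneous as Homogeneous
open import Data.Nat.Base using (ℕ; zero; suc; _+_)
open import Data.Product.Base using (Σ-syntax; ∃-syntax; _×_)
open import Data.Vec.Base using (Vec; []; _∷_; replicate; zipWith; _[_]≔_)
open import Data.Vec.Relation.Binary.Pointwise.Inductive using (Pointwise)
open import Function.Base using (_∘_; id)
open import Level using (0ℓ)
open import Relation.Binary.Construct.Closure.ReflexiveTransitive using (Star)
open import Relation.Binary.Construct.Union using (_∪_)
open import Relation.Binary.Core using (Rel)
open import Relation.Nullary.Negation using (¬_)

private
  variable
    m n b e : ℕ

------------------------------------------------------------------------
-- Terms

infixl 8 _·_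
infixl 9 _[\_]
infixr 7 ƛ_

-- Terms modulo α-conversion are well-scoped de Bruijn terms: `Term n`
-- has its free variables among n given ones.  In `ƛ t` and in
-- `t [\ u ]` the bound variable is the index zero of t.

data Term (n : ℕ) : Set where
  var   : Fin n → Term n
  ƛ_    : Term (suc n) → Term n
  _·_   : Term n → Term n → Term n
  _[\_] : Term (suc n) → Term n → Term n

data Value {n : ℕ} : Term n → Set where
  var : (x : Fin n) → Value (var x)
  ƛ_  : (t : Term (suc n)) → Value (ƛ t)

∣_∣ : Term n → ℕ
∣ var x ∣    = 0
∣ ƛ t ∣      = 0
∣ t · u ∣    = 1 + ∣ t ∣ + ∣ u ∣
∣ t [\ u ] ∣ = 1 + ∣ t ∣ + ∣ u ∣

Ren : ℕ → ℕ → Set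
Ren m n = Fin m → Fin n

liftR : Ren m n → Ren (suc m) (suc n)
liftR ρ zero    = zero
liftR ρ (suc x) = suc (ρ x)

rename : Ren m n → Term m → Term n
rename ρ (var x)    = var (ρ x)
rename ρ (ƛ t)      = ƛ rename (liftR ρ) t
rename ρ (t · u)    = rename ρ t · rename ρ u
rename ρ (t [\ u ]) = rename (liftR ρ) t [\ rename ρ u ]

Sub : ℕ → ℕ → Set
Sub m n = Fin m → Term n

liftS : Sub m n → Sub (suc m) (suc n)
liftS θ zero    = var zero
liftS θ (suc x) = rename suc (θ x)

subst : Sub m n → Term m → Term n
subst θ (var x)    = θ x
subst θ (ƛ t)      = ƛ subst (liftS θ) t
subst θ (t · u)    = subst θ t · subst θ u
subst θ (t [\ u ]) = subst (liftS θ) t [\ subst θ u ]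

sub₀ : Term n → Sub (suc n) n
sub₀ u zero    = u
sub₀ u (suc x) = var x

_⟪_⟫ : Term (suc n) → Term n → Term n
t ⟪ u ⟫ = subst (sub₀ u) t

------------------------------------------------------------------------
-- Contexts

-- In `LCtx m n` and `VCtx m n`, n is the scope of the hole and m the
-- scope of the plugged term; plugging may capture variables.

data LCtx : ℕ → ℕ → Set where
  □     : LCtx n n
  _[\_] : LCtx (suc m) n → Term m → LCtx m n

_⟨_⟩ᴸ : LCtx m n → Term n → Term m
□          ⟨ t ⟩ᴸ = t
(L [\ u ]) ⟨ t ⟩ᴸ = L ⟨ t ⟩ᴸ [\ u ]

-- The weakening past the binders of L, which keeps a term moved under L
-- from being captured.

wk : LCtx m n → Ren m n
wk □          = id
wk (L [\ u ]) = wk L ∘ suc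

data VCtx : ℕ → ℕ → Set where
  □      : VCtx n n
  _·ˡ_   : VCtx m n → Term m → VCtx m n
  _·ʳ_   : Term m → VCtx m n → VCtx m n
  _[\_]ˡ : VCtx (suc m) n → Term m → VCtx m n
  _[\_]ʳ : Term (suc m) → VCtx m n → VCtx m n

_⟨_⟩ⱽ : VCtx m n → Term n → Term m
□           ⟨ r ⟩ⱽ = r
(V ·ˡ u)    ⟨ r ⟩ⱽ = V ⟨ r ⟩ⱽ · u
(t ·ʳ V)    ⟨ r ⟩ⱽ = t · V ⟨ r ⟩ⱽ
(V [\ u ]ˡ) ⟨ r ⟩ⱽ = V ⟨ r ⟩ⱽ [\ u ]
(t [\ V ]ʳ) ⟨ r ⟩ⱽ = t [\ V ⟨ r ⟩ⱽ ]

------------------------------------------------------------------------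
-- Reduction

infix 4 _↦dB_ _↦sv_ _⟶dB_ _⟶sv_ _⟶v_ _↠v⟨_,_⟩_

data _↦dB_ {m : ℕ} : Rel (Term m) 0ℓ where
  dB : (L : LCtx m n) (t : Term (suc n)) (u : Term m) →
       L ⟨ ƛ t ⟩ᴸ · u ↦dB L ⟨ t [\ rename (wk L) u ] ⟩ᴸ

data _↦sv_ {m : ℕ} : Rel (Term m) 0ℓ where
  sv : (t : Term (suc m)) (L : LCtx m n) {v : Term n} → Value v →
       t [\ L ⟨ v ⟩ᴸ ] ↦sv L ⟨ rename (liftR (wk L)) t ⟪ v ⟫ ⟩ᴸ

data Closure (R : ∀ {n} → Rel (Term n) 0ℓ) {m : ℕ} : Rel (Term m) 0ℓ where
  close : (V : VCtx m n) {r r′ : Term n} → R r r′ →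
          Closure R (V ⟨ r ⟩ⱽ) (V ⟨ r′ ⟩ⱽ)

_⟶dB_ _⟶sv_ _⟶v_ : Rel (Term m) 0ℓ
_⟶dB_ = Closure _↦dB_
_⟶sv_ = Closure _↦sv_
_⟶v_  = Closure (_↦dB_ ∪ _↦sv_)

data _↠v⟨_,_⟩_ {m : ℕ} : Term m → ℕ → ℕ → Term m → Set where
  done    : {t : Term m} → t ↠v⟨ 0 , 0 ⟩ t
  step-dB : {t u p : Term m} → t ⟶dB u → u ↠v⟨ b , e ⟩ p → t ↠v⟨ suc b , e ⟩ p
  step-sv : {t u p : Term m} → t ⟶sv u → u ↠v⟨ b , e ⟩ p → t ↠v⟨ b , suc e ⟩ p

Normalising : Term n → Set
Normalising t = ∃[ p ] Star _⟶v_ t p × (∀ q → ¬ (p ⟶v q))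

------------------------------------------------------------------------
-- Normal forms

data Vr {n : ℕ} : Term n → Set
data Ne {n : ℕ} : Term n → Set
data No {n : ℕ} : Term n → Set

data Vr {n} where
  var   : (x : Fin n) → Vr (var x)
  _[\_] : {t : Term (suc n)} {u : Term n} → Vr t → Ne u → Vr (t [\ u ])

data Ne {n} where
  vr·   : {t u : Term n} → Vr t → No u → Ne (t · u)
  ne·   : {t u : Term n} → Ne t → No u → Ne (t · u)
  _[\_] : {t : Term (suc n)} {u : Term n} → Ne t → Ne u → Ne (t [\ u ])

data No {n} where
  ƛ_    : (t : Term (suc n)) → No (ƛ t)
  vr    : {t : Term n} → Vr t → No t
  ne    : {t : Term n} → Ne t → No t
  _[\_] : {t : Term (suc n)} {u : Term n} → No t → Ne u → No (t [\ u ])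

------------------------------------------------------------------------
-- Types

infixr 7 _⇒_
infix 4 _≈_ _↭_ _≈ᶜ_

-- A finite multiset of types is represented by a list.  Equality of
-- multisets is `_↭_`, permutation up to `_≈_`, where `_≈_` is the induced
-- equality of types (permutations are allowed at any depth).

data Ty : Set where
  base : ℕ → Ty
  mul  : List Ty → Ty
  _⇒_  : List Ty → Ty → Ty

Multi : Set
Multi = List Ty

data _≈_ : Rel Ty 0ℓ where
  base : (a : ℕ) → base a ≈ base a
  mul  : {M N : Multi} → Homogeneous.Permutation _≈_ M N → mul M ≈ mul N
  _⇒_  : {M N : Multi} {σ τ : Ty} →
         Homogeneous.Permutation _≈_ M N → σ ≈ τ → M ⇒ σ ≈ N ⇒ τ

_↭_ : Rel Multi 0ℓ
_↭_ = Homogeneous.Permutation _≈_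

-- Typing contexts for terms in scope n; every variable out of scope is
-- implicitly mapped to the empty multiset.

Ctx : ℕ → Set
Ctx n = Vec Multi n

∅ : Ctx n
∅ = replicate _ []

_↦_ : Fin n → Multi → Ctx n
x ↦ M = ∅ [ x ]≔ M

infixl 6 _⊎_

_⊎_ : Ctx n → Ctx n → Ctx n
_⊎_ = zipWith _++_

_≈ᶜ_ : Rel (Ctx n) 0ℓ
_≈ᶜ_ = Pointwise _↭_

------------------------------------------------------------------------
-- System 𝒱

infix 3 _⊢_∶_ _⊩_∶_

data _⊢_∶_ {n : ℕ} : Ctx n → Term n → Ty → Set
data _⊩_∶_ {n : ℕ} : Ctx n → Term (suc n) → Multi → Set

-- If Γ types the body t of a binder, then Γ is M ∷ Γ′ where M is the
-- multiset of the bound variable x and Γ′ is Γ with x removed.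
-- Contexts and multiset types in conclusions are only determined up to
-- multiset equality, so judgements are invariant under `_≈ᶜ_` and `_≈_`
-- and the premises may share M literally.

data _⊢_∶_ {n} where
  ax  : {Γ : Ctx n} (x : Fin n) (M : Multi) →
        Γ ≈ᶜ x ↦ M →
        Γ ⊢ var x ∶ mul M
  es  : {Γ Δ Θ : Ctx n} {M : Multi} {t : Term (suc n)} {u : Term n} {σ : Ty} →
        M ∷ Γ ⊢ t ∶ σ → Δ ⊢ u ∶ mul M →
        Θ ≈ᶜ Γ ⊎ Δ →
        Θ ⊢ t [\ u ] ∶ σ
  abs : {Γ Θ : Ctx n} {M N : Multi} {t : Term (suc n)} →
        Γ ⊩ t ∶ N →
        Θ ≈ᶜ Γ → M ↭ N →
        Θ ⊢ ƛ t ∶ mul M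
  app : {Γ Δ Θ : Ctx n} {M : Multi} {t u : Term n} {τ : Ty} →
        Γ ⊢ t ∶ mul (M ⇒ τ ∷ []) → Δ ⊢ u ∶ mul M →
        Θ ≈ᶜ Γ ⊎ Δ →
        Θ ⊢ t · u ∶ τ

-- The finite family of premises of `abs`: Γ ⊩ t ∶ N holds when Γ is the
-- sum of the Γᵢ and N lists the types Mᵢ ⇒ τᵢ, for derivations of
-- Mᵢ ∷ Γᵢ ⊢ t ∶ τᵢ.

data _⊩_∶_ {n} where
  []  : {t : Term (suc n)} → ∅ ⊩ t ∶ []
  _∷_ : {Γ Δ : Ctx n} {M N : Multi} {t : Term (suc n)} {τ : Ty} →
        M ∷ Γ ⊢ t ∶ τ → Δ ⊩ t ∶ N →
        Γ ⊎ Δ ⊩ t ∶ M ⇒ τ ∷ N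

Typable : Term n → Set
Typable {n} t = Σ[ Γ ∈ Ctx n ] Σ[ σ ∈ Ty ] (Γ ⊢ t ∶ σ)

sz  : {Γ : Ctx n} {t : Term n} {σ : Ty} → Γ ⊢ t ∶ σ → ℕ
szs : {Γ : Ctx n} {t : Term (suc n)} {N : Multi} → Γ ⊩ t ∶ N → ℕ

sz (ax x M _)          = length M
sz (es Φ Ψ _)          = 1 + sz Φ + sz Ψ
sz (abs {N = N} Φs _ _) = length N + szs Φs
sz (app Φ Ψ _)         = 1 + sz Φ + sz Ψ

szs []       = 0
szs (Φ ∷ Φs) = sz Φ + szs Φs

{-# OPTIONS --safe #-}
-- Every term is in no or has a reduct, and no consists of irreducible terms,
-- so everything reduces to subject reduction and expansion.  Substituting a
-- value v : M for x cuts the derivation for v along the axioms for x; these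
-- axioms have total size |M|, so sz does not grow and the constructor
-- consumed by a dB or sv step makes it drop strictly.  Since moreover
-- |t| ≤ sz Φ for every Φ : Γ ⊢ t : σ, induction on sz Φ gives the bound.
-- Conversely an anti-substitution lemma yields expansion, and every term in
-- no has type [] because ne takes any type and vr any multiset type.

module Submission where

open import Defs
open import Algebra.Bundles using (CommutativeMonoid)
import Algebra.Properties.CommutativeSemigroup as CommutativeSemigroupProperties
open import Data.Fin.Base using (Fin; zero; suc)
open import Data.List.Base using ([]; _∷_; _++_; length)
open import Data.List.Properties using (length-++)
open import Data.List.Relation.Binary.Permutation.Homogeneous
  using (refl; prep; swap; trans)
import Data.List.Relation.Binary.Permutation.Setoid as Permutation
import Data.List.Relation.Binary.Permutation.Setoid.Properties as PermutationProperties
open import Data.List.Relation.Binary.Pointwise.Base as Listwise using ([]; _∷_)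
open import Data.Nat.Base using (ℕ; zero; suc; _+_; _≤_; _<_; _≥_; z≤n; s≤s; s≤s⁻¹)
open import Data.Nat.Properties
  using (≤-refl; ≤-reflexive; ≤-trans; +-mono-≤; +-monoˡ-≤; +-suc; +-assoc; +-identityʳ;
         m≤n+m; m≤m+n; +-monoʳ-≤; +-monoˡ-<; +-monoʳ-<; +-commutativeSemigroup; module ≤-Reasoning)
open import Data.Product.Base
  using (Σ-syntax; ∃-syntax; _×_; _,_; proj₁; proj₂)
open import Data.Sum.Base using (inj₁; inj₂)
open import Data.Vec.Base using ([]; _∷_; insertAt)
import Data.Vec.Relation.Binary.Pointwise.Inductive as Vecwise
open import Data.Vec.Relation.Binary.Pointwise.Inductive using ([]; _∷_)
open import Function.Base using (_∘_; id)
open import Function.Bundles using (_⇔_; mk⇔)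
open import Level using (0ℓ)
open import Relation.Binary.Bundles using (Setoid)
open import Relation.Binary.Construct.Closure.ReflexiveTransitive using (Star; ε; _◅_)
open import Relation.Binary.Construct.Union using (_∪_)
open import Relation.Binary.PropositionalEquality as ≡
  using (_≡_; _≗_; refl; cong; cong₂)
open import Relation.Binary.Core using (Rel)
open import Relation.Nullary.Negation using (¬_)

private
  variable
    m n k : ℕ
    a b c d r s : ℕ
    M N M₁ M₂ : Multi
    σ τ : Ty
    t u v : Term n
    Γ Γ′ Γ₁ Γ₂ Δ Δ₁ Δ₂ Θ Θ₁ Θ₂ : Ctx n

module + = CommutativeSemigroupProperties +-commutativeSemigroup

-- Multisets and typing contexts

≈-refl : σ ≈ σ
≋-refl : Listwise.Pointwise _≈_ M M
≈-refl {base a} = base a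
≈-refl {mul M}  = mul (refl ≋-refl)
≈-refl {M ⇒ σ}  = refl ≋-refl ⇒ ≈-refl
≋-refl {[]}     = []
≋-refl {σ ∷ M}  = ≈-refl ∷ ≋-refl

≈-sym : σ ≈ τ → τ ≈ σ
↭-sym : M ↭ N → N ↭ M
≋-sym : Listwise.Pointwise _≈_ M N → Listwise.Pointwise _≈_ N M
≈-sym (base a)      = base a
≈-sym (mul p)       = mul (↭-sym p)
≈-sym (p ⇒ e)       = ↭-sym p ⇒ ≈-sym e
↭-sym (refl qs)     = refl (≋-sym qs)
↭-sym (prep e p)    = prep (≈-sym e) (↭-sym p)
↭-sym (swap e f p)  = swap (≈-sym f) (≈-sym e) (↭-sym p)
↭-sym (trans p q)   = trans (↭-sym q) (↭-sym p)
≋-sym []            = []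
≋-sym (e ∷ qs)      = ≈-sym e ∷ ≋-sym qs

≈-trans : ∀ {ρ} → ρ ≈ σ → σ ≈ τ → ρ ≈ τ
≈-trans (base a) (base a) = base a
≈-trans (mul p)  (mul q)  = mul (trans p q)
≈-trans (p ⇒ e)  (q ⇒ f)  = trans p q ⇒ ≈-trans e f

≈-setoid : Setoid 0ℓ 0ℓ
≈-setoid = record
  { Carrier       = Ty
  ; _≈_           = _≈_
  ; isEquivalence = record { refl = ≈-refl ; sym = ≈-sym ; trans = ≈-trans }
  }

open Permutation ≈-setoid using (↭-refl)
open PermutationProperties ≈-setoid
  using (++⁺; ++-assoc; ++-comm; ++-identityʳ)
  renaming (xs↭ys⇒|xs|≡|ys| to ↭-length)

↭-empty : M ↭ [] → M ≡ []
↭-empty {[]}    p = refl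
↭-empty {_ ∷ _} p with () ← ↭-length p

⊎-cong : Γ₁ ≈ᶜ Γ₂ → Δ₁ ≈ᶜ Δ₂ → Γ₁ ⊎ Δ₁ ≈ᶜ Γ₂ ⊎ Δ₂
⊎-cong []       []       = []
⊎-cong (p ∷ ps) (q ∷ qs) = ++⁺ p q ∷ ⊎-cong ps qs

⊎-assoc : (Γ Δ Θ : Ctx n) → (Γ ⊎ Δ) ⊎ Θ ≈ᶜ Γ ⊎ (Δ ⊎ Θ)
⊎-assoc []      []      []      = []
⊎-assoc (L ∷ Γ) (M ∷ Δ) (N ∷ Θ) = ++-assoc L M N ∷ ⊎-assoc Γ Δ Θ

⊎-comm : (Γ Δ : Ctx n) → Γ ⊎ Δ ≈ᶜ Δ ⊎ Γ
⊎-comm []      []      = []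
⊎-comm (M ∷ Γ) (N ∷ Δ) = ++-comm M N ∷ ⊎-comm Γ Δ

⊎-identityˡ : (Γ : Ctx n) → ∅ ⊎ Γ ≡ Γ
⊎-identityˡ []      = refl
⊎-identityˡ (M ∷ Γ) = cong (M ∷_) (⊎-identityˡ Γ)

⊎-identityʳ : (Γ : Ctx n) → Γ ⊎ ∅ ≈ᶜ Γ
⊎-identityʳ []      = []
⊎-identityʳ (M ∷ Γ) = ++-identityʳ M ∷ ⊎-identityʳ Γ

≈ᶜ-refl : Γ ≈ᶜ Γ
≈ᶜ-refl = Vecwise.refl ↭-refl

≈ᶜ-reflexive : Γ ≡ Δ → Γ ≈ᶜ Δ
≈ᶜ-reflexive refl = ≈ᶜ-refl

≈ᶜ-sym : Γ ≈ᶜ Δ → Δ ≈ᶜ Γ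
≈ᶜ-sym = Vecwise.sym ↭-sym

≈ᶜ-trans : Γ ≈ᶜ Δ → Δ ≈ᶜ Θ → Γ ≈ᶜ Θ
≈ᶜ-trans = Vecwise.trans trans

-- Bundled to make the laws of commutative semigroups, such as `interchange`, available for sums of
-- contexts.
⊎-commutativeMonoid : ℕ → CommutativeMonoid 0ℓ 0ℓ
⊎-commutativeMonoid n = record
  { Carrier = Ctx n
  ; _≈_     = _≈ᶜ_
  ; _∙_     = _⊎_
  ; ε       = ∅
  ; isCommutativeMonoid = record
    { isMonoid = record
      { isSemigroup = record
        { isMagma = record
          { isEquivalence = record { refl = ≈ᶜ-refl ; sym = ≈ᶜ-sym ; trans = ≈ᶜ-trans }
          ; ∙-cong        = ⊎-cong
          }
        ; assoc = ⊎-assoc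
        }
      ; identity = ≈ᶜ-reflexive ∘ ⊎-identityˡ , ⊎-identityʳ
      }
    ; comm = ⊎-comm
    }
  }

module ⊎ {n} =
  CommutativeSemigroupProperties (CommutativeMonoid.commutativeSemigroup (⊎-commutativeMonoid n))

-- Serves to push a substitution into two premises, where the value's context and the remaining
-- context are split simultaneously.
⊎-medial : ∀ (Δ₁ : Ctx n) Γ₁ Δ₂ Γ₂ →
           Δ ≈ᶜ Δ₁ ⊎ Δ₂ → Γ ≈ᶜ Γ₁ ⊎ Γ₂ → Δ ⊎ Γ ≈ᶜ (Δ₁ ⊎ Γ₁) ⊎ (Δ₂ ⊎ Γ₂)
⊎-medial Δ₁ Γ₁ Δ₂ Γ₂ p q = ≈ᶜ-trans (⊎-cong p q) (⊎.interchange Δ₁ Δ₂ Γ₁ Γ₂)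

⊎-medial⁻ : ∀ (Δ₁ : Ctx n) Γ₁ Δ₂ Γ₂ → Θ ≈ᶜ Θ₁ ⊎ Θ₂ → Θ₁ ≈ᶜ Δ₁ ⊎ Γ₁ → Θ₂ ≈ᶜ Δ₂ ⊎ Γ₂ →
            Θ ≈ᶜ (Δ₁ ⊎ Δ₂) ⊎ (Γ₁ ⊎ Γ₂)
⊎-medial⁻ Δ₁ Γ₁ Δ₂ Γ₂ p q r =
  ≈ᶜ-trans p (≈ᶜ-trans (⊎-cong q r) (⊎.interchange Δ₁ Γ₁ Δ₂ Γ₂))

↦-cong : (x : Fin n) → M ↭ N → x ↦ M ≈ᶜ x ↦ N
↦-cong zero    p = p ∷ ≈ᶜ-refl
↦-cong (suc x) p = refl [] ∷ ↦-cong x p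

↦-++ : (x : Fin n) → x ↦ (M ++ N) ≡ (x ↦ M) ⊎ (x ↦ N)
↦-++ zero    = cong (_ ∷_) (≡.sym (⊎-identityˡ ∅))
↦-++ (suc x) = cong ([] ∷_) (↦-++ x)

↦-[] : (x : Fin n) → x ↦ [] ≡ ∅
↦-[] zero    = refl
↦-[] (suc x) = cong ([] ∷_) (↦-[] x)

insertAt-cong : ∀ k → Γ ≈ᶜ Δ → M ↭ N → insertAt Γ k M ≈ᶜ insertAt Δ k N
insertAt-cong zero    ps       q = q ∷ ps
insertAt-cong (suc k) (p ∷ ps) q = p ∷ insertAt-cong k ps q

insertAt-injective : ∀ (Γ Δ : Ctx n) k → insertAt Γ k M ≈ᶜ insertAt Δ k N → Γ ≈ᶜ Δ × M ↭ N
insertAt-injective Γ       Δ       zero    (q ∷ ps) = ps , q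
insertAt-injective (_ ∷ Γ) (_ ∷ Δ) (suc k) (p ∷ ps) =
  let ps′ , q = insertAt-injective Γ Δ k ps in p ∷ ps′ , q

insertAt-⊎ : ∀ (Γ Δ : Ctx n) k →
             insertAt (Γ ⊎ Δ) k (M ++ N) ≡ insertAt Γ k M ⊎ insertAt Δ k N
insertAt-⊎ Γ       Δ       zero    = refl
insertAt-⊎ (_ ∷ Γ) (_ ∷ Δ) (suc k) = cong (_ ∷_) (insertAt-⊎ Γ Δ k)

insertAt-∅ : ∀ k → insertAt (∅ {n}) k [] ≡ ∅
insertAt-∅         zero    = refl
insertAt-∅ {suc n} (suc k) = cong ([] ∷_) (insertAt-∅ k)

insertAt-∅-↦ : ∀ k → insertAt (∅ {n}) k M ≡ k ↦ M
insertAt-∅-↦         zero    = refl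
insertAt-∅-↦ {suc n} (suc k) = cong ([] ∷_) (insertAt-∅-↦ k)

-- `insertAt Γ k M` singles out the variable `k`. The split tells which types of `k`, hence which
-- part of the value's derivation, each premise needs.
insertAt-split : ∀ (Γ : Ctx n) k → insertAt Γ k M ≈ᶜ Θ₁ ⊎ Θ₂ →
  ∃[ Γ₁ ] ∃[ Γ₂ ] ∃[ M₁ ] ∃[ M₂ ]
    (Θ₁ ≡ insertAt Γ₁ k M₁ × Θ₂ ≡ insertAt Γ₂ k M₂ × Γ ≈ᶜ Γ₁ ⊎ Γ₂ × M ↭ M₁ ++ M₂)
insertAt-split {Θ₁ = _ ∷ Θ₁} {_ ∷ Θ₂} Γ zero (q ∷ ps) =
  Θ₁ , Θ₂ , _ , _ , refl , refl , ps , q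
insertAt-split {Θ₁ = _ ∷ _} {_ ∷ _} (_ ∷ Γ) (suc k) (p ∷ ps)
  with _ , _ , _ , _ , refl , refl , ps′ , q ← insertAt-split Γ k ps
  = _ , _ , _ , _ , refl , refl , p ∷ ps′ , q

-- Conversion, permutation and splitting of derivations

-- The side conditions of the rules absorb the conversion, or it moves to the first premise. An
-- axiom keeps its size because permutations preserve length.
conv : Δ ≈ᶜ Γ → σ ≈ τ → (Φ : Γ ⊢ t ∶ σ) → Σ[ Φ′ ∈ Δ ⊢ t ∶ τ ] sz Φ′ ≡ sz Φ
conv Δ≈Γ (mul p) (ax x M eq) =
  ax x _ (≈ᶜ-trans Δ≈Γ (≈ᶜ-trans eq (↦-cong x p))) , ≡.sym (↭-length p)
conv Δ≈Γ σ≈τ (es Φ Ψ eq) =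
  let Φ′ , e = conv ≈ᶜ-refl σ≈τ Φ
  in es Φ′ Ψ (≈ᶜ-trans Δ≈Γ eq) , cong (λ s → suc s + sz Ψ) e
conv Δ≈Γ (mul p) (abs Φs eq q) =
  abs Φs (≈ᶜ-trans Δ≈Γ eq) (trans (↭-sym p) q) , refl
conv Δ≈Γ σ≈τ (app Φ Ψ eq) =
  let Φ′ , e = conv ≈ᶜ-refl (mul (prep (↭-refl ⇒ σ≈τ) ↭-refl)) Φ
  in app Φ′ Ψ (≈ᶜ-trans Δ≈Γ eq) , cong (λ s → suc s + sz Ψ) e

reindex : Δ ≈ᶜ Γ → Γ ⊢ t ∶ σ → Δ ⊢ t ∶ σ
reindex p Φ = proj₁ (conv p ≈-refl Φ)

permute-pointwise : Listwise.Pointwise _≈_ M N → (Φs : Γ ⊩ t ∶ M) →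
                    Σ[ Φs′ ∈ Γ ⊩ t ∶ N ] szs Φs′ ≡ szs Φs
permute-pointwise []             []       = [] , refl
permute-pointwise ((p ⇒ e) ∷ qs) (Φ ∷ Φs) =
  let Φ′ , eq = conv (↭-sym p ∷ ≈ᶜ-refl) e Φ
      Φs′ , eqs = permute-pointwise qs Φs
  in Φ′ ∷ Φs′ , cong₂ _+_ eq eqs

-- The context of a family is literally a sum in the order of its premises, so reordering preserves
-- it only up to `≈ᶜ`.
permute : M ↭ N → (Φs : Γ ⊩ t ∶ M) →
          ∃[ Δ ] (Γ ≈ᶜ Δ × Σ[ Φs′ ∈ Δ ⊩ t ∶ N ] szs Φs′ ≡ szs Φs)
permute (refl qs) Φs = _ , ≈ᶜ-refl , permute-pointwise qs Φs
permute (prep (p ⇒ e) ps) (Φ ∷ Φs) =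
  let Φ′ , eq = conv (↭-sym p ∷ ≈ᶜ-refl) e Φ
      _ , Γ≈Δ , Φs′ , eqs = permute ps Φs
  in _ , ⊎-cong ≈ᶜ-refl Γ≈Δ , Φ′ ∷ Φs′ , cong₂ _+_ eq eqs
permute (swap (p ⇒ e) (q ⇒ f) ps) (_∷_ {Γ₁} Φ (_∷_ {Γ₂} {Γ₃} Ψ Φs)) =
  let Φ′ , eq₁ = conv (↭-sym p ∷ ≈ᶜ-refl) e Φ
      Ψ′ , eq₂ = conv (↭-sym q ∷ ≈ᶜ-refl) f Ψ
      Δ , Γ≈Δ , Φs′ , eqs = permute ps Φs
  in _ ,
     ≈ᶜ-trans (⊎-cong ≈ᶜ-refl (⊎-cong ≈ᶜ-refl Γ≈Δ)) (⊎.x∙yz≈y∙xz Γ₁ Γ₂ Δ) ,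
     Ψ′ ∷ Φ′ ∷ Φs′ ,
     ≡.trans (cong₂ _+_ eq₂ (cong₂ _+_ eq₁ eqs)) (+.x∙yz≈y∙xz (sz Ψ) (sz Φ) (szs Φs))
permute (trans p q) Φs =
  let _ , Γ≈Δ , Φs′ , eq = permute p Φs
      _ , Δ≈Θ , Φs″ , eq′ = permute q Φs′
  in _ , ≈ᶜ-trans Γ≈Δ Δ≈Θ , Φs″ , ≡.trans eq′ eq

⊩-split : ∀ M → (Φs : Γ ⊩ t ∶ M ++ N) →
  ∃[ Γ₁ ] ∃[ Γ₂ ] (Γ ≈ᶜ Γ₁ ⊎ Γ₂ ×
    Σ[ Φs₁ ∈ Γ₁ ⊩ t ∶ M ] Σ[ Φs₂ ∈ Γ₂ ⊩ t ∶ N ] szs Φs ≡ szs Φs₁ + szs Φs₂)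
⊩-split {Γ = Γ} [] Φs =
  ∅ , Γ , ≈ᶜ-reflexive (≡.sym (⊎-identityˡ Γ)) , [] , Φs , refl
⊩-split (_ ∷ M) (_∷_ {Δ} Φ Φs) =
  let Γ₁ , Γ₂ , p , Φs₁ , Φs₂ , eq = ⊩-split M Φs
  in _ , _ , ≈ᶜ-trans (⊎-cong ≈ᶜ-refl p) (≈ᶜ-sym (⊎-assoc Δ Γ₁ Γ₂)) , Φ ∷ Φs₁ , Φs₂ ,
     ≡.trans (cong (sz Φ +_) eq) (≡.sym (+-assoc (sz Φ) _ _))

⊩-join : Γ₁ ⊩ t ∶ M → Γ₂ ⊩ t ∶ N → ∃[ Γ ] (Γ₁ ⊎ Γ₂ ≈ᶜ Γ × Γ ⊩ t ∶ M ++ N)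
⊩-join {Γ₂ = Γ₂} [] Ψs = _ , ≈ᶜ-reflexive (⊎-identityˡ Γ₂) , Ψs
⊩-join {Γ₂ = Γ₂} (_∷_ {Γ} {Δ} Φ Φs) Ψs =
  let _ , p , Φs′ = ⊩-join Φs Ψs
  in _ , ≈ᶜ-trans (⊎-assoc Γ Δ Γ₂) (⊎-cong ≈ᶜ-refl p) , Φ ∷ Φs′

-- Typing of values

value-mul : Value v → Γ ⊢ v ∶ σ → ∃[ M ] σ ≡ mul M
value-mul _ (ax _ _ _)  = _ , refl
value-mul _ (abs _ _ _) = _ , refl

-- Retypes, for expansion, a value that substitution has erased.
value-∅ : {v : Term n} → Value v → ∅ ⊢ v ∶ mul []
value-∅ (var x) = ax x [] (≈ᶜ-reflexive (≡.sym (↦-[] x)))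
value-∅ (ƛ t)   = abs [] ≈ᶜ-refl ↭-refl

value-∅⁻ : Value v → Γ ⊢ v ∶ mul [] → Γ ≈ᶜ ∅
value-∅⁻ _ (ax x _ eq) = ≈ᶜ-trans eq (≈ᶜ-reflexive (↦-[] x))
value-∅⁻ _ (abs Φs eq p) with refl ← ↭-empty (↭-sym p) with [] ← Φs = eq

-- The size is exactly additive: an axiom counts the elements of its multiset, and an abstraction
-- has one premise per element, each counted once.
value-split : ∀ M₁ → Value v → M ↭ M₁ ++ M₂ → (Φ : Γ ⊢ v ∶ mul M) →
  ∃[ Γ₁ ] ∃[ Γ₂ ] (Γ ≈ᶜ Γ₁ ⊎ Γ₂ ×
    Σ[ Φ₁ ∈ Γ₁ ⊢ v ∶ mul M₁ ] Σ[ Φ₂ ∈ Γ₂ ⊢ v ∶ mul M₂ ] sz Φ₁ + sz Φ₂ ≡ sz Φ)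
value-split M₁ _ p (ax x M eq) =
  _ , _ , ≈ᶜ-trans eq (≈ᶜ-trans (↦-cong x p) (≈ᶜ-reflexive (↦-++ x))) ,
  ax x M₁ ≈ᶜ-refl , ax x _ ≈ᶜ-refl ,
  ≡.trans (≡.sym (length-++ M₁)) (≡.sym (↭-length p))
value-split {M₂ = M₂} M₁ _ p (abs {N = N} Φs eq q) =
  let _ , Γ≈Δ , Φs′ , e = permute (trans (↭-sym q) p) Φs
      _ , _ , Δ≈ , Φs₁ , Φs₂ , e′ = ⊩-split M₁ Φs′
  in _ , _ , ≈ᶜ-trans eq (≈ᶜ-trans Γ≈Δ Δ≈) ,
     abs Φs₁ ≈ᶜ-refl ↭-refl , abs Φs₂ ≈ᶜ-refl ↭-refl ,
     ≡.trans (+.interchange (length M₁) (szs Φs₁) (length M₂) (szs Φs₂))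
       (cong₂ _+_
         (≡.trans (≡.sym (length-++ M₁)) (↭-length (trans (↭-sym p) q)))
         (≡.trans (≡.sym e′) e))

value-join : Value v → Γ₁ ⊢ v ∶ mul M₁ → Γ₂ ⊢ v ∶ mul M₂ → Γ₁ ⊎ Γ₂ ⊢ v ∶ mul (M₁ ++ M₂)
value-join (var _) (ax x _ p) (ax x _ q) =
  ax x _ (≈ᶜ-trans (⊎-cong p q) (≈ᶜ-reflexive (≡.sym (↦-++ x))))
value-join (ƛ _) (abs Φs p q) (abs Ψs p′ q′) =
  let _ , eq , Φs′ = ⊩-join Φs Ψs
  in abs Φs′ (≈ᶜ-trans (⊎-cong p p′) eq) (++⁺ q q′)

-- Weakening

-- `punchIn k` up to pointwise equality; in this form the weakening under a
-- binder is definitionally the lifted one.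
wkAt : Fin (suc n) → Ren n (suc n)
wkAt         zero    = suc
wkAt {suc n} (suc k) = liftR (wkAt k)

↦-wkAt : ∀ k (x : Fin n) → wkAt k x ↦ M ≡ insertAt (x ↦ M) k []
↦-wkAt         zero    x       = refl
↦-wkAt {suc n} (suc k) zero    = cong (_ ∷_) (≡.sym (insertAt-∅ k))
↦-wkAt {suc n} (suc k) (suc x) = cong ([] ∷_) (↦-wkAt k x)

insertAt-⊎-[] : ∀ (Γ Δ : Ctx n) k → Θ ≈ᶜ Γ ⊎ Δ →
                insertAt Θ k [] ≈ᶜ insertAt Γ k [] ⊎ insertAt Δ k []
insertAt-⊎-[] Γ Δ k p =
  ≈ᶜ-trans (insertAt-cong k p ↭-refl) (≈ᶜ-reflexive (insertAt-⊎ Γ Δ k))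

weaken : ∀ k (Φ : Γ ⊢ t ∶ σ) →
         Σ[ Φ′ ∈ insertAt Γ k [] ⊢ rename (wkAt k) t ∶ σ ] sz Φ′ ≡ sz Φ
weakens : ∀ k (Φs : Γ ⊩ t ∶ N) →
          ∃[ Δ ] (insertAt Γ k [] ≈ᶜ Δ ×
            Σ[ Φs′ ∈ Δ ⊩ rename (wkAt (suc k)) t ∶ N ] szs Φs′ ≡ szs Φs)
weaken k (ax x M p) =
  ax (wkAt k x) M
     (≈ᶜ-trans (insertAt-cong k p ↭-refl) (≈ᶜ-reflexive (≡.sym (↦-wkAt k x)))) ,
  refl
weaken k (es {Γ} {Δ} Φ Ψ p) =
  let Φ′ , e = weaken (suc k) Φ
      Ψ′ , f = weaken k Ψ
  in es Φ′ Ψ′ (insertAt-⊎-[] Γ Δ k p) , cong suc (cong₂ _+_ e f)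
weaken k (abs {N = N} Φs p q) =
  let _ , p′ , Φs′ , e = weakens k Φs
  in abs Φs′ (≈ᶜ-trans (insertAt-cong k p ↭-refl) p′) q , cong (length N +_) e
weaken k (app {Γ} {Δ} Φ Ψ p) =
  let Φ′ , e = weaken k Φ
      Ψ′ , f = weaken k Ψ
  in app Φ′ Ψ′ (insertAt-⊎-[] Γ Δ k p) , cong suc (cong₂ _+_ e f)
weakens k []       = ∅ , ≈ᶜ-reflexive (insertAt-∅ k) , [] , refl
weakens k (_∷_ {Γ} {Δ} Φ Φs) =
  let Φ′ , e = weaken (suc k) Φ
      _ , p , Φs′ , f = weakens k Φs
  in _ , ≈ᶜ-trans (insertAt-⊎-[] Γ Δ k ≈ᶜ-refl) (⊎-cong ≈ᶜ-refl p) ,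
     Φ′ ∷ Φs′ , cong₂ _+_ e f

insertAt-⊎-[]⁻ : ∀ (Γ Δ : Ctx n) k → Θ ≈ᶜ Θ₁ ⊎ Θ₂ →
  Θ₁ ≈ᶜ insertAt Γ k [] → Θ₂ ≈ᶜ insertAt Δ k [] → Θ ≈ᶜ insertAt (Γ ⊎ Δ) k []
insertAt-⊎-[]⁻ Γ Δ k p q r =
  ≈ᶜ-trans p (≈ᶜ-trans (⊎-cong q r) (≈ᶜ-reflexive (≡.sym (insertAt-⊎ Γ Δ k))))

-- The recursion is on the term, whose shape determines that of the renamed term. A renamed variable
-- is never `k`, so `k` receives the empty multiset.
strengthen : ∀ k (t : Term n) → Δ ⊢ rename (wkAt k) t ∶ σ →
             ∃[ Γ ] (Δ ≈ᶜ insertAt Γ k [] × Γ ⊢ t ∶ σ)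
strengthens : ∀ k (t : Term (suc n)) → Δ ⊩ rename (wkAt (suc k)) t ∶ N →
              ∃[ Γ ] (Δ ≈ᶜ insertAt Γ k [] × Γ ⊩ t ∶ N)
strengthen k (var x) (ax _ M p) =
  x ↦ M , ≈ᶜ-trans p (≈ᶜ-reflexive (↦-wkAt k x)) , ax x M ≈ᶜ-refl
strengthen k (ƛ t) (abs Φs p q) =
  let Γ , r , Φs′ = strengthens k t Φs
  in Γ , ≈ᶜ-trans p r , abs Φs′ ≈ᶜ-refl q
strengthen k (t · u) (app Φ Ψ p) =
  let Γ , q , Φ′ = strengthen k t Φ
      Δ , r , Ψ′ = strengthen k u Ψ
  in Γ ⊎ Δ , insertAt-⊎-[]⁻ Γ Δ k p q r , app Φ′ Ψ′ ≈ᶜ-refl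
strengthen k (t [\ u ]) (es Φ Ψ p) with strengthen (suc k) t Φ | strengthen k u Ψ
... | _ ∷ Γ , q₀ ∷ q , Φ′ | Δ , r , Ψ′ =
  -- The bound multiset comes back only up to permutation; `q₀` restores the literal one that `Ψ′`
  -- shares.
  Γ ⊎ Δ , insertAt-⊎-[]⁻ Γ Δ k p q r , es (reindex (q₀ ∷ ≈ᶜ-refl) Φ′) Ψ′ ≈ᶜ-refl
strengthens k t [] = ∅ , ≈ᶜ-reflexive (≡.sym (insertAt-∅ k)) , []
strengthens k t (Φ ∷ Φs) with strengthen (suc k) t Φ | strengthens k t Φs
... | _ ∷ Γ , q₀ ∷ q , Φ′ | Δ , r , Φs′ =
  Γ ⊎ Δ , insertAt-⊎-[]⁻ Γ Δ k ≈ᶜ-refl q r , reindex (q₀ ∷ ≈ᶜ-refl) Φ′ ∷ Φs′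

-- Substitution

-- θ substitutes v for the variable k and removes that variable.
data Single : Fin (suc n) → Term n → Sub (suc n) n → Set where
  zero : Single {n} zero v (sub₀ v)
  suc  : ∀ {k} {θ : Sub (suc n) n} → Single k v θ → Single (suc k) (rename suc v) (liftS θ)

-- A view of `θ x` for a single substitution; matching on it refines the variable and its image
-- together.
data Image {n} (k : Fin (suc n)) (v : Term n) : Fin (suc n) → Term n → Set where
  hit  : Image k v k v
  miss : ∀ y → Image k v (wkAt k y) (var y)

image : ∀ {k} {θ : Sub (suc n) n} → Single k v θ → ∀ x → Image k v x (θ x)
image zero          zero    = hit
image zero          (suc x) = miss x
image (suc S)       zero    = miss zero
image (suc {θ = θ} S) (suc x) with θ x | image S x
... | _ | hit    = hit
... | _ | miss y = miss (suc y)

value-rename : ∀ (ρ : Ren m n) → Value v → Value (rename ρ v)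
value-rename ρ (var x) = var (ρ x)
value-rename ρ (ƛ t)   = ƛ rename (liftR ρ) t

split-≤ : a ≤ r + c → b ≤ s + d → c + d ≡ k → a + b ≤ (r + s) + k
split-≤ {r = r} {c} {s = s} {d} p q refl =
  ≤-trans (+-mono-≤ p q) (≤-reflexive (+.interchange r c s d))

-- The axiom case. On a hit, Γ is empty and Ψ replaces the axiom; on a miss, M is empty and Ψ is
-- dropped.
image-typing : ∀ {k x} {Γ : Ctx n} → Image k v x u → Value v →
  insertAt Γ k M ≈ᶜ x ↦ N → (Ψ : Δ ⊢ v ∶ mul M) →
  Σ[ Φ ∈ Δ ⊎ Γ ⊢ u ∶ mul N ] sz Φ ≤ length N + sz Ψ
image-typing {N = N} {Δ} {k} {Γ = Γ} hit V p Ψ =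
  let Γ≈∅ , M↭N = insertAt-injective Γ ∅ k
                     (≈ᶜ-trans p (≈ᶜ-reflexive (≡.sym (insertAt-∅-↦ k))))
      Ψ′ , e = conv (≈ᶜ-trans (⊎-cong ≈ᶜ-refl Γ≈∅) (⊎-identityʳ Δ)) (mul M↭N) Ψ
  in Ψ′ , ≤-trans (≤-reflexive e) (m≤n+m _ (length N))
image-typing {N = N} {Δ} {k} {Γ = Γ} (miss y) V p Ψ
  with Γ≈ , M↭[] ← insertAt-injective Γ (y ↦ N) k
                      (≈ᶜ-trans p (≈ᶜ-reflexive (↦-wkAt k y)))
  with refl ← ↭-empty M↭[] =
  ax y N (≈ᶜ-trans (⊎-cong (value-∅⁻ V Ψ) Γ≈) (≈ᶜ-reflexive (⊎-identityˡ _))) ,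
  m≤m+n (length N) _

-- The context of the value comes first so that, under a binder, the
-- multiset of the bound variable is [] ++ M, which reduces to M.
substitution : ∀ {k θ} {Γ : Ctx n} → Single k v θ → Value v →
  (Φ : Θ ⊢ t ∶ σ) → insertAt Γ k M ≈ᶜ Θ → (Ψ : Δ ⊢ v ∶ mul M) →
  Σ[ Φ′ ∈ Δ ⊎ Γ ⊢ subst θ t ∶ σ ] sz Φ′ ≤ sz Φ + sz Ψ
substitutions : ∀ {k θ} {Γ : Ctx n} → Single k v θ → Value v →
  (Φs : Θ ⊩ t ∶ N) → insertAt Γ k M ≈ᶜ Θ → (Ψ : Δ ⊢ v ∶ mul M) →
  ∃[ Γ′ ] (Δ ⊎ Γ ≈ᶜ Γ′ ×
    Σ[ Φs′ ∈ Γ′ ⊩ subst (liftS θ) t ∶ N ] szs Φs′ ≤ szs Φs + sz Ψ)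
substitution S V (ax x M p) q Ψ = image-typing (image S x) V (≈ᶜ-trans q p) Ψ
substitution {k = k} {Γ = Γ} S V (es Φ₁ Φ₂ p) q Ψ
  -- Each premise receives the part of Ψ for the types of `k` it uses; the sizes of the two parts
  -- add up to `sz Ψ`.
  with Γ₁ , Γ₂ , M₁ , _ , refl , refl , p′ , M↭ ← insertAt-split Γ k (≈ᶜ-trans q p)
  with Δ₁ , Δ₂ , Δ≈ , Ψ₁ , Ψ₂ , e ← value-split M₁ V M↭ Ψ
  with Ψ₁′ , e₁ ← weaken zero Ψ₁ =
  let Φ₁′ , l₁ = substitution (suc S) (value-rename suc V) Φ₁ ≈ᶜ-refl Ψ₁′
      Φ₂′ , l₂ = substitution S V Φ₂ ≈ᶜ-refl Ψ₂
  in es Φ₁′ Φ₂′ (⊎-medial Δ₁ Γ₁ Δ₂ Γ₂ Δ≈ p′) ,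
     s≤s (split-≤ {r = sz Φ₁} {s = sz Φ₂} l₁ l₂ (≡.trans (cong (_+ sz Ψ₂) e₁) e))
substitution S V (abs {N = N} Φs p q) r Ψ =
  let _ , p′ , Φs′ , l = substitutions S V Φs (≈ᶜ-trans r p) Ψ
  in abs Φs′ p′ q ,
     ≤-trans (+-monoʳ-≤ (length N) l) (≤-reflexive (≡.sym (+-assoc (length N) _ _)))
substitution {k = k} {Γ = Γ} S V (app Φ₁ Φ₂ p) q Ψ
  with Γ₁ , Γ₂ , M₁ , _ , refl , refl , p′ , M↭ ← insertAt-split Γ k (≈ᶜ-trans q p)
  with Δ₁ , Δ₂ , Δ≈ , Ψ₁ , Ψ₂ , e ← value-split M₁ V M↭ Ψ =
  let Φ₁′ , l₁ = substitution S V Φ₁ ≈ᶜ-refl Ψ₁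
      Φ₂′ , l₂ = substitution S V Φ₂ ≈ᶜ-refl Ψ₂
  in app Φ₁′ Φ₂′ (⊎-medial Δ₁ Γ₁ Δ₂ Γ₂ Δ≈ p′) ,
     s≤s (split-≤ {r = sz Φ₁} {s = sz Φ₂} l₁ l₂ e)
substitutions {k = k} {Γ = Γ} S V [] q Ψ
  -- A family without premises has the empty context, so M is empty and the value brings no context
  -- either.
  with Γ≈∅ , M↭[] ← insertAt-injective Γ ∅ k
                       (≈ᶜ-trans q (≈ᶜ-reflexive (≡.sym (insertAt-∅ k))))
  with refl ← ↭-empty M↭[] =
  _ , ≈ᶜ-trans (⊎-cong (value-∅⁻ V Ψ) Γ≈∅) (⊎-identityʳ ∅) , [] , z≤n
substitutions {k = k} {Γ = Γ} S V (Φ ∷ Φs) q Ψ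
  with Γ₁ , Γ₂ , M₁ , _ , refl , refl , p′ , M↭ ← insertAt-split Γ k q
  with Δ₁ , Δ₂ , Δ≈ , Ψ₁ , Ψ₂ , e ← value-split M₁ V M↭ Ψ
  with Ψ₁′ , e₁ ← weaken zero Ψ₁ =
  let Φ′ , l₁ = substitution (suc S) (value-rename suc V) Φ ≈ᶜ-refl Ψ₁′
      _ , p″ , Φs′ , l₂ = substitutions S V Φs ≈ᶜ-refl Ψ₂
  in _ , ≈ᶜ-trans (⊎-medial Δ₁ Γ₁ Δ₂ Γ₂ Δ≈ p′) (⊎-cong ≈ᶜ-refl p″) , Φ′ ∷ Φs′ ,
     split-≤ {r = sz Φ} {s = szs Φs} l₁ l₂ (≡.trans (cong (_+ sz Ψ₂) e₁) e)

-- Anti-substitution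

AntiSubst : Ctx n → Fin (suc n) → Term (suc n) → Term n → Ty → Set
AntiSubst Θ k t v σ =
  ∃[ Δ ] ∃[ Γ ] ∃[ M ]
    (Θ ≈ᶜ Δ ⊎ Γ × Δ ⊢ v ∶ mul M × insertAt Γ k M ⊢ t ∶ σ)

-- The extra Θ′ is the literal sum indexing the family, which agrees with `insertAt Γ k M` only up
-- to `≈ᶜ`.
AntiSubsts : Ctx n → Fin (suc n) → Term (suc (suc n)) → Term n → Multi → Set
AntiSubsts Θ k t v N =
  ∃[ Δ ] ∃[ Γ ] ∃[ M ] ∃[ Θ′ ]
    (Θ ≈ᶜ Δ ⊎ Γ × Δ ⊢ v ∶ mul M × insertAt Γ k M ≈ᶜ Θ′ × Θ′ ⊩ t ∶ N)

insertAt-join : ∀ (Γ₁ Γ₂ : Ctx n) k → insertAt Γ₁ k M₁ ≈ᶜ Θ₁ → insertAt Γ₂ k M₂ ≈ᶜ Θ₂ →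
                insertAt (Γ₁ ⊎ Γ₂) k (M₁ ++ M₂) ≈ᶜ Θ₁ ⊎ Θ₂
insertAt-join Γ₁ Γ₂ k p q =
  ≈ᶜ-trans (≈ᶜ-reflexive (insertAt-⊎ Γ₁ Γ₂ k)) (⊎-cong p q)

-- On a hit the whole context goes to the value; on a miss the value is typed by the empty multiset.
image-antityping : ∀ {k x} → Image k v x u → Value v → Θ ⊢ u ∶ σ → AntiSubst Θ k (var x) v σ
image-antityping {Θ = Θ} {k = k} hit V Φ with M , refl ← value-mul V Φ =
  Θ , ∅ , M , ≈ᶜ-sym (⊎-identityʳ Θ) , Φ , ax k M (≈ᶜ-reflexive (insertAt-∅-↦ k))
image-antityping {Θ = Θ} {k = k} (miss y) V (ax _ N p) =
  ∅ , Θ , [] , ≈ᶜ-reflexive (≡.sym (⊎-identityˡ Θ)) , value-∅ V ,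
  ax (wkAt k y) N (≈ᶜ-trans (insertAt-cong k p ↭-refl) (≈ᶜ-reflexive (≡.sym (↦-wkAt k y))))

-- Leaves the scope of a binder: the weakened value gives the bound variable the empty multiset, so
-- all of N stays with the body.
antisubst-unlift : ∀ {k} {v : Term n} → AntiSubst (N ∷ Θ) (suc k) t (rename suc v) σ →
  ∃[ Δ ] ∃[ Γ ] ∃[ M ]
    (Θ ≈ᶜ Δ ⊎ Γ × Δ ⊢ v ∶ mul M × N ∷ insertAt Γ k M ⊢ t ∶ σ)
antisubst-unlift {v = v} (_ ∷ Δ , _ ∷ Γ , M , p₀ ∷ p , Ψ , Φ)
  with Δ′ , q₀ ∷ q , Ψ′ ← strengthen zero v Ψ =
  Δ′ , Γ , M , ≈ᶜ-trans p (⊎-cong q ≈ᶜ-refl) , Ψ′ ,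
  reindex (trans p₀ (++⁺ q₀ ↭-refl) ∷ ≈ᶜ-refl) Φ

-- Different premises may type their copies of the value with different multisets; `value-join` adds
-- these up.
antisubstitution : ∀ {k θ} → Single k v θ → Value v → (t : Term (suc n)) →
                   Θ ⊢ subst θ t ∶ σ → AntiSubst Θ k t v σ
antisubstitutions : ∀ {k θ} → Single k v θ → Value v → (t : Term (suc (suc n))) →
                    Θ ⊩ subst (liftS θ) t ∶ N → AntiSubsts Θ k t v N
antisubstitution S V (var x) Φ = image-antityping (image S x) V Φ
antisubstitution S V (ƛ t) (abs Φs p q) =
  let Δ , Γ , M , _ , r , Ψ , r′ , Φs′ = antisubstitutions S V t Φs
  in Δ , Γ , M , ≈ᶜ-trans p r , Ψ , abs Φs′ r′ q
antisubstitution {k = k} S V (t · u) (app Φ₁ Φ₂ p) =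
  let Δ₁ , Γ₁ , _ , q₁ , Ψ₁ , Φ₁′ = antisubstitution S V t Φ₁
      Δ₂ , Γ₂ , _ , q₂ , Ψ₂ , Φ₂′ = antisubstitution S V u Φ₂
  in _ , _ , _ , ⊎-medial⁻ Δ₁ Γ₁ Δ₂ Γ₂ p q₁ q₂ , value-join V Ψ₁ Ψ₂ ,
     app Φ₁′ Φ₂′ (insertAt-join Γ₁ Γ₂ k ≈ᶜ-refl ≈ᶜ-refl)
antisubstitution {k = k} S V (t [\ u ]) (es Φ₁ Φ₂ p) =
  let Δ₁ , Γ₁ , _ , q₁ , Ψ₁ , Φ₁′ =
        antisubst-unlift (antisubstitution (suc S) (value-rename suc V) t Φ₁)
      Δ₂ , Γ₂ , _ , q₂ , Ψ₂ , Φ₂′ = antisubstitution S V u Φ₂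
  in _ , _ , _ , ⊎-medial⁻ Δ₁ Γ₁ Δ₂ Γ₂ p q₁ q₂ , value-join V Ψ₁ Ψ₂ ,
     es Φ₁′ Φ₂′ (insertAt-join Γ₁ Γ₂ k ≈ᶜ-refl ≈ᶜ-refl)
antisubstitutions {k = k} S V t [] =
  ∅ , ∅ , [] , ∅ , ≈ᶜ-sym (⊎-identityʳ ∅) , value-∅ V , ≈ᶜ-reflexive (insertAt-∅ k) , []
antisubstitutions {k = k} S V t (Φ ∷ Φs) =
  let Δ₁ , Γ₁ , _ , q₁ , Ψ₁ , Φ′ =
        antisubst-unlift (antisubstitution (suc S) (value-rename suc V) t Φ)
      Δ₂ , Γ₂ , _ , _ , q₂ , Ψ₂ , r , Φs′ = antisubstitutions S V t Φs
  in _ , _ , _ , _ , ⊎-medial⁻ Δ₁ Γ₁ Δ₂ Γ₂ ≈ᶜ-refl q₁ q₂ , value-join V Ψ₁ Ψ₂ ,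
     insertAt-join Γ₁ Γ₂ k ≈ᶜ-refl r , Φ′ ∷ Φs′

-- Renaming

liftR-cong : ∀ {ρ ρ′ : Ren m n} → ρ ≗ ρ′ → liftR ρ ≗ liftR ρ′
liftR-cong e zero    = refl
liftR-cong e (suc x) = cong suc (e x)

rename-cong : ∀ {ρ ρ′ : Ren m n} → ρ ≗ ρ′ → rename ρ ≗ rename ρ′
rename-cong e (var x)    = cong var (e x)
rename-cong e (ƛ t)      = cong ƛ_ (rename-cong (liftR-cong e) t)
rename-cong e (t · u)    = cong₂ _·_ (rename-cong e t) (rename-cong e u)
rename-cong e (t [\ u ]) = cong₂ _[\_] (rename-cong (liftR-cong e) t) (rename-cong e u)

liftR-id : liftR (id {A = Fin n}) ≗ id
liftR-id zero    = refl
liftR-id (suc x) = refl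

-- Needed because `wk □` is `id`. The pointwise hypothesis passes under binders, as `liftR id`
-- equals `id` only pointwise.
rename-id : ∀ {ρ : Ren n n} → ρ ≗ id → rename ρ ≗ id
rename-id e (var x)    = cong var (e x)
rename-id e (ƛ t)      = cong ƛ_ (rename-id (λ x → ≡.trans (liftR-cong e x) (liftR-id x)) t)
rename-id e (t · u)    = cong₂ _·_ (rename-id e t) (rename-id e u)
rename-id e (t [\ u ]) =
  cong₂ _[\_] (rename-id (λ x → ≡.trans (liftR-cong e x) (liftR-id x)) t) (rename-id e u)

liftR-∘ : ∀ (ρ′ : Ren m n) (ρ : Ren k m) → liftR (ρ′ ∘ ρ) ≗ liftR ρ′ ∘ liftR ρ
liftR-∘ ρ′ ρ zero    = refl
liftR-∘ ρ′ ρ (suc x) = refl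

rename-∘ : ∀ (ρ′ : Ren m n) (ρ : Ren k m) → rename (ρ′ ∘ ρ) ≗ rename ρ′ ∘ rename ρ
rename-∘ ρ′ ρ (var x)    = refl
rename-∘ ρ′ ρ (ƛ t)      =
  cong ƛ_ (≡.trans (rename-cong (liftR-∘ ρ′ ρ) t) (rename-∘ (liftR ρ′) (liftR ρ) t))
rename-∘ ρ′ ρ (t · u)    = cong₂ _·_ (rename-∘ ρ′ ρ t) (rename-∘ ρ′ ρ u)
rename-∘ ρ′ ρ (t [\ u ]) =
  cong₂ _[\_]
    (≡.trans (rename-cong (liftR-∘ ρ′ ρ) t) (rename-∘ (liftR ρ′) (liftR ρ) t))
    (rename-∘ ρ′ ρ u)

rename-liftR-∘ : ∀ (ρ′ : Ren m n) (ρ : Ren k m) →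
                 rename (liftR (ρ′ ∘ ρ)) ≗ rename (liftR ρ′) ∘ rename (liftR ρ)
rename-liftR-∘ ρ′ ρ t =
  ≡.trans (rename-cong (liftR-∘ ρ′ ρ) t) (rename-∘ (liftR ρ′) (liftR ρ) t)

-- Subject reduction and subject expansion

-- Induction on L. The context of the moved argument comes first: weakened, it contributes `[]` to
-- the binder, and `[] ++ M` reduces to M.
dB-reduction : ∀ (L : LCtx m n) t u (Φ : Γ ⊢ L ⟨ ƛ t ⟩ᴸ ∶ mul (M ⇒ σ ∷ [])) (Ψ : Δ ⊢ u ∶ mul M) →
  Σ[ Φ′ ∈ Δ ⊎ Γ ⊢ L ⟨ t [\ rename (wk L) u ] ⟩ᴸ ∶ σ ] sz Φ′ ≤ sz Φ + sz Ψ
dB-reduction {Γ = Γ} {Δ = Δ} □ t u (abs {N = N} Φs p q) Ψ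
  rewrite rename-id (λ _ → refl) u
  -- The type is a singleton, so the abstraction has one premise; the 1 it counts pays for the new
  -- `es`.
  with _ , p′ , _∷_ {Γ₁} Φ [] , e ← permute (↭-sym q) Φs =
  es Φ Ψ (≈ᶜ-trans (⊎-comm Δ Γ) (⊎-cong (≈ᶜ-trans p (≈ᶜ-trans p′ (⊎-identityʳ Γ₁))) ≈ᶜ-refl)) ,
  ≤-reflexive (cong (_+ sz Ψ)
    (cong₂ _+_ (↭-length q) (≡.trans (≡.sym (+-identityʳ (sz Φ))) e)))
dB-reduction {Δ = Δ} (L [\ s ]) t u (es {Γ₁} {Γ₂} Φ Φₛ p) Ψ
  rewrite rename-∘ (wk L) suc u
  with Ψ′ , e ← weaken zero Ψ
  with Φ′ , l ← dB-reduction L t (rename suc u) Φ Ψ′ =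
  es Φ′ Φₛ (≈ᶜ-trans (⊎-cong ≈ᶜ-refl p) (≈ᶜ-sym (⊎-assoc Δ Γ₁ Γ₂))) ,
  s≤s (begin
    sz Φ′ + sz Φₛ         ≤⟨ +-monoˡ-≤ (sz Φₛ) l ⟩
    sz Φ + sz Ψ′ + sz Φₛ  ≡⟨ cong (λ s → sz Φ + s + sz Φₛ) e ⟩
    sz Φ + sz Ψ + sz Φₛ   ≡⟨ +.xy∙z≈xz∙y (sz Φ) (sz Ψ) (sz Φₛ) ⟩
    sz Φ + sz Φₛ + sz Ψ   ∎)
  where open ≤-Reasoning

dB-expansion : ∀ (L : LCtx m n) t u → Θ ⊢ L ⟨ t [\ rename (wk L) u ] ⟩ᴸ ∶ σ →
  ∃[ Δ ] ∃[ Γ ] ∃[ M ]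
    (Θ ≈ᶜ Δ ⊎ Γ × Δ ⊢ u ∶ mul M × Γ ⊢ L ⟨ ƛ t ⟩ᴸ ∶ mul (M ⇒ σ ∷ []))
dB-expansion □ t u Φ
  rewrite rename-id (λ _ → refl) u
  with es {Γ} {Δ} Φₜ Φᵤ p ← Φ =
  Δ , Γ , _ , ≈ᶜ-trans p (⊎-comm Γ Δ) , Φᵤ ,
  abs (Φₜ ∷ []) (≈ᶜ-sym (⊎-identityʳ Γ)) ↭-refl
dB-expansion (L [\ s ]) t u Φ
  rewrite rename-∘ (wk L) suc u
  with es {Δ = Θ₂} Φ₁ Φₛ p ← Φ
  with _ ∷ Δ , _ ∷ Γ , _ , q₀ ∷ q , Ψ , Φ₁′ ← dB-expansion L t (rename suc u) Φ₁
  with Δ′ , r₀ ∷ r , Ψ′ ← strengthen zero u Ψ =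
  Δ′ , _ , _ ,
  ≈ᶜ-trans p (≈ᶜ-trans (⊎-cong (≈ᶜ-trans q (⊎-cong r ≈ᶜ-refl)) ≈ᶜ-refl) (⊎-assoc Δ′ Γ Θ₂)) ,
  Ψ′ ,
  es (reindex (trans q₀ (++⁺ r₀ ↭-refl) ∷ ≈ᶜ-refl) Φ₁′) Φₛ ≈ᶜ-refl

-- Here the body `t` is what moves under L, so its context comes first.
sv-reduction : ∀ (L : LCtx m n) t → Value v → (Φ : M ∷ Γ ⊢ t ∶ σ) (Ψ : Δ ⊢ L ⟨ v ⟩ᴸ ∶ mul M) →
  Σ[ Φ′ ∈ Γ ⊎ Δ ⊢ L ⟨ rename (liftR (wk L)) t ⟪ v ⟫ ⟩ᴸ ∶ σ ] sz Φ′ ≤ sz Φ + sz Ψ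
sv-reduction {Γ = Γ} {Δ = Δ} □ t V Φ Ψ
  rewrite rename-id liftR-id t =
  let Φ′ , l = substitution zero V Φ ≈ᶜ-refl Ψ
      Φ″ , e = conv (⊎-comm Γ Δ) ≈-refl Φ′
  in Φ″ , ≤-trans (≤-reflexive e) l
sv-reduction {Γ = Γ} (L [\ s ]) t V Φ (es {Δ₁} {Δ₂} Ψ Ψₛ p)
  rewrite rename-liftR-∘ (wk L) suc t
  with Φ′ , e ← weaken (suc zero) Φ
  with Φ″ , l ← sv-reduction L (rename (liftR suc) t) V Φ′ Ψ =
  es Φ″ Ψₛ (≈ᶜ-trans (⊎-cong ≈ᶜ-refl p) (≈ᶜ-sym (⊎-assoc Γ Δ₁ Δ₂))) ,
  (begin
    suc (sz Φ″ + sz Ψₛ)         ≤⟨ s≤s (+-monoˡ-≤ (sz Ψₛ) l) ⟩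
    suc (sz Φ′ + sz Ψ + sz Ψₛ)  ≡⟨ cong (λ s → suc (s + sz Ψ + sz Ψₛ)) e ⟩
    suc (sz Φ + sz Ψ + sz Ψₛ)   ≡⟨ cong suc (+-assoc (sz Φ) (sz Ψ) (sz Ψₛ)) ⟩
    suc (sz Φ + (sz Ψ + sz Ψₛ)) ≡⟨ ≡.sym (+-suc (sz Φ) (sz Ψ + sz Ψₛ)) ⟩
    sz Φ + suc (sz Ψ + sz Ψₛ)   ∎)
  where open ≤-Reasoning

sv-expansion : ∀ (L : LCtx m n) t → Value v → Θ ⊢ L ⟨ rename (liftR (wk L)) t ⟪ v ⟫ ⟩ᴸ ∶ σ →
  ∃[ Γ ] ∃[ Δ ] ∃[ M ]
    (Θ ≈ᶜ Γ ⊎ Δ × M ∷ Γ ⊢ t ∶ σ × Δ ⊢ L ⟨ v ⟩ᴸ ∶ mul M)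
sv-expansion □ t V Φ
  rewrite rename-id liftR-id t =
  let Δ , Γ , M , p , Ψ , Φ′ = antisubstitution zero V t Φ
  in Γ , Δ , M , ≈ᶜ-trans p (⊎-comm Δ Γ) , Φ′ , Ψ
sv-expansion (L [\ s ]) t V Φ
  rewrite rename-liftR-∘ (wk L) suc t
  with es {Δ = Θ₂} Φ₁ Φₛ p ← Φ
  with _ ∷ Γ , _ ∷ Δ , _ , q₀ ∷ q , Φ₁′ , Ψ ← sv-expansion L (rename (liftR suc) t) V Φ₁
  -- Index zero of the renamed body is the substituted variable, so the binder of `s` has index one.
  -- The body does not use it, and its multiset belongs to the answer.
  with _ ∷ Γ′ , r₀ ∷ r₁ ∷ r , Φ₁″ ← strengthen (suc zero) t Φ₁′ =
  Γ′ , _ , _ ,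
  ≈ᶜ-trans p (≈ᶜ-trans (⊎-cong (≈ᶜ-trans q (⊎-cong r ≈ᶜ-refl)) ≈ᶜ-refl) (⊎-assoc Γ′ Δ Θ₂)) ,
  reindex (r₀ ∷ ≈ᶜ-refl) Φ₁″ ,
  es (reindex (trans q₀ (++⁺ r₁ ↭-refl) ∷ ≈ᶜ-refl) Ψ) Φₛ ≈ᶜ-refl

-- The strict decrease arises here: the reduct is bounded by the premises, and the consumed `app` or
-- `es` counted one more.
root-reduction : (_↦dB_ ∪ _↦sv_) t u → (Φ : Γ ⊢ t ∶ σ) → Σ[ Φ′ ∈ Γ ⊢ u ∶ σ ] sz Φ′ < sz Φ
root-reduction (inj₁ (dB L t u)) (app {Γ} {Δ} Φ Ψ p) =
  let Φ′ , l = dB-reduction L t u Φ Ψ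
      Φ″ , e = conv (≈ᶜ-trans p (⊎-comm Γ Δ)) ≈-refl Φ′
  in Φ″ , s≤s (≤-trans (≤-reflexive e) l)
root-reduction (inj₂ (sv t L V)) (es Φ Ψ p) =
  let Φ′ , l = sv-reduction L t V Φ Ψ
      Φ″ , e = conv p ≈-refl Φ′
  in Φ″ , s≤s (≤-trans (≤-reflexive e) l)

root-expansion : (_↦dB_ ∪ _↦sv_) t u → Γ ⊢ u ∶ σ → Γ ⊢ t ∶ σ
root-expansion (inj₁ (dB L t u)) Φ =
  let Δ , Γ , _ , p , Ψ , Φ′ = dB-expansion L t u Φ
  in app Φ′ Ψ (≈ᶜ-trans p (⊎-comm Δ Γ))
root-expansion (inj₂ (sv t L V)) Φ =
  let _ , _ , _ , p , Φ′ , Ψ = sv-expansion L t V Φ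
  in es Φ′ Ψ p

-- Contexts V never enter an abstraction, so the redex is typed exactly once and its decrease
-- carries over.
subject-reduction : t ⟶v u → (Φ : Γ ⊢ t ∶ σ) → Σ[ Φ′ ∈ Γ ⊢ u ∶ σ ] sz Φ′ < sz Φ
subject-reduction (close □ R) Φ = root-reduction R Φ
subject-reduction (close (V ·ˡ _) R) (app Φ Ψ p) =
  let Φ′ , l = subject-reduction (close V R) Φ
  in app Φ′ Ψ p , s≤s (+-monoˡ-< (sz Ψ) l)
subject-reduction (close (_ ·ʳ V) R) (app Φ Ψ p) =
  let Ψ′ , l = subject-reduction (close V R) Ψ
  in app Φ Ψ′ p , s≤s (+-monoʳ-< (sz Φ) l)
subject-reduction (close (V [\ _ ]ˡ) R) (es Φ Ψ p) =
  let Φ′ , l = subject-reduction (close V R) Φ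
  in es Φ′ Ψ p , s≤s (+-monoˡ-< (sz Ψ) l)
subject-reduction (close (_ [\ V ]ʳ) R) (es Φ Ψ p) =
  let Ψ′ , l = subject-reduction (close V R) Ψ
  in es Φ Ψ′ p , s≤s (+-monoʳ-< (sz Φ) l)

subject-expansion : t ⟶v u → Γ ⊢ u ∶ σ → Γ ⊢ t ∶ σ
subject-expansion (close □ R)          Φ           = root-expansion R Φ
subject-expansion (close (V ·ˡ _) R)   (app Φ Ψ p) = app (subject-expansion (close V R) Φ) Ψ p
subject-expansion (close (_ ·ʳ V) R)   (app Φ Ψ p) = app Φ (subject-expansion (close V R) Ψ) p
subject-expansion (close (V [\ _ ]ˡ) R) (es Φ Ψ p)  = es (subject-expansion (close V R) Φ) Ψ p
subject-expansion (close (_ [\ V ]ʳ) R) (es Φ Ψ p)  = es Φ (subject-expansion (close V R) Ψ) p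

-- Normal forms

-- Resolves the overlaps in the grammar of `No`: the shape decides whether a root step fires.
data Shape {n} : Term n → Set where
  vr  : Vr t → Shape t
  ne  : Ne t → Shape t
  fun : (L : LCtx n m) (t : Term (suc m)) → Shape (L ⟨ ƛ t ⟩ᴸ)

shape : No t → Shape t
shape (ƛ t)  = fun □ t
shape (vr N) = vr N
shape (ne N) = ne N
shape (N [\ U ]) with shape N
... | vr N′   = vr (N′ [\ U ])
... | ne N′   = ne (N′ [\ U ])
... | fun L t = fun (L [\ _ ]) t

-- Answers and progress

data Answer {n} : Term n → Set where
  answer : (L : LCtx n m) → Value v → Answer (L ⟨ v ⟩ᴸ)

vr-answer : Vr t → Answer t
vr-answer (var x) = answer □ (var x)
vr-answer (N [\ U ]) with vr-answer N
... | answer L V = answer (L [\ _ ]) V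

-- The two kinds of step are kept apart because they are counted separately.
data Progress {n} (t : Term n) : Set where
  normal  : No t → Progress t
  dB-step : t ⟶dB u → Progress t
  sv-step : t ⟶sv u → Progress t

-- Closure is assumed for every R, so that one function lifts both kinds of step.
progress-in : (f : Term m → Term n) →
  (∀ {R : ∀ {k} → Rel (Term k) 0ℓ} {u} → Closure R t u → Closure R (f t) (f u)) →
  Progress t → (No t → Progress (f t)) → Progress (f t)
progress-in f close-f (normal N)  g = g N
progress-in f close-f (dB-step S) g = dB-step (close-f S)
progress-in f close-f (sv-step S) g = sv-step (close-f S)

progress-· : No t → No u → Progress (t · u)
progress-· N N′ with shape N
... | vr W    = normal (ne (vr· W N′))
... | ne U    = normal (ne (ne· U N′))
... | fun L t = dB-step (close □ (dB L t _))

progress-[\] : No t → No u → Progress (t [\ u ])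
progress-[\] N N′ with shape N′
... | ne U    = normal (N [\ U ])
... | fun L t = sv-step (close □ (sv _ L (ƛ t)))
... | vr W with answer L V ← vr-answer W = sv-step (close □ (sv _ L V))

progress : (t : Term n) → Progress t
progress (var x)    = normal (vr (var x))
progress (ƛ t)      = normal (ƛ t)
progress (t · u)    =
  progress-in (_· u) (λ { (close V R) → close (V ·ˡ u) R }) (progress t) λ N →
  progress-in (t ·_) (λ { (close V R) → close (t ·ʳ V) R }) (progress u) λ N′ →
  progress-· N N′
progress (t [\ u ]) =
  progress-in _[\ u ] (λ { (close V R) → close (V [\ u ]ˡ) R }) (progress t) λ N →
  progress-in (t [\_]) (λ { (close V R) → close (t [\ V ]ʳ) R }) (progress u) λ N′ →
  progress-[\] N N′

-- Irreducibility of normal forms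

dB⇒v : t ⟶dB u → t ⟶v u
dB⇒v (close V R) = close V (inj₁ R)

sv⇒v : t ⟶sv u → t ⟶v u
sv⇒v (close V R) = close V (inj₂ R)

no-·⁻ : No (t · u) → No t × No u
no-·⁻ (ne (vr· W N)) = vr W , N
no-·⁻ (ne (ne· U N)) = ne U , N

no-[\]⁻ : No (t [\ u ]) → No t × Ne u
no-[\]⁻ (vr (W [\ U ])) = vr W , U
no-[\]⁻ (ne (W [\ U ])) = ne W , U
no-[\]⁻ (N [\ U ])      = N , U

fun-not-vr : ∀ (L : LCtx m n) → ¬ Vr (L ⟨ ƛ t ⟩ᴸ)
fun-not-vr (L [\ _ ]) (W [\ _ ]) = fun-not-vr L W

-- Below its explicit substitutions a `Ne` term is an application, while an answer has a value
-- there.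
answer-not-ne : ∀ (L : LCtx m n) → Value v → ¬ Ne (L ⟨ v ⟩ᴸ)
answer-not-ne □          (var x) ()
answer-not-ne □          (ƛ t)   ()
answer-not-ne (L [\ _ ]) V       (U [\ _ ]) = answer-not-ne L V U

no-irreducible : No t → ¬ (t ⟶v u)
no-irreducible N (close □ (inj₁ (dB L t _))) with N
... | ne (vr· W _) = fun-not-vr L W
... | ne (ne· U _) = answer-not-ne L (ƛ t) U
no-irreducible N (close □ (inj₂ (sv _ L V))) = answer-not-ne L V (proj₂ (no-[\]⁻ N))
no-irreducible N (close (V ·ˡ _) R)   = no-irreducible (proj₁ (no-·⁻ N)) (close V R)
no-irreducible N (close (_ ·ʳ V) R)   = no-irreducible (proj₂ (no-·⁻ N)) (close V R)
no-irreducible N (close (V [\ _ ]ˡ) R) = no-irreducible (proj₁ (no-[\]⁻ N)) (close V R)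
no-irreducible N (close (_ [\ V ]ʳ) R) = no-irreducible (ne (proj₂ (no-[\]⁻ N))) (close V R)

irreducible-no : (∀ u → ¬ (t ⟶v u)) → No t
irreducible-no {t = t} irr with progress t
... | normal N  = N
... | dB-step S with () ← irr _ (dB⇒v S)
... | sv-step S with () ← irr _ (sv⇒v S)

-- Typability of normal forms and the size bound

vr-typable : Vr t → ∀ M → ∃[ Γ ] (Γ ⊢ t ∶ mul M)
ne-typable : Ne t → ∀ σ → ∃[ Γ ] (Γ ⊢ t ∶ σ)
no-typable : No t → ∃[ Γ ] (Γ ⊢ t ∶ mul [])
vr-typable (var x) M = _ , ax x M ≈ᶜ-refl
-- The body is typed first; the neutral argument, typable with any type, then takes the multiset N
-- found for the bound variable.
vr-typable (W [\ U ]) M with N ∷ _ , Φ ← vr-typable W M =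
  _ , es Φ (proj₂ (ne-typable U (mul N))) ≈ᶜ-refl
ne-typable (vr· W N) σ =
  -- The domain is empty because the argument is only known to have type `mul []`.
  _ , app (proj₂ (vr-typable W ([] ⇒ σ ∷ []))) (proj₂ (no-typable N)) ≈ᶜ-refl
ne-typable (ne· U N) σ =
  _ , app (proj₂ (ne-typable U (mul ([] ⇒ σ ∷ [])))) (proj₂ (no-typable N)) ≈ᶜ-refl
ne-typable (W [\ U ]) σ with N ∷ _ , Φ ← ne-typable W σ =
  _ , es Φ (proj₂ (ne-typable U (mul N))) ≈ᶜ-refl
no-typable (ƛ t)  = _ , abs [] ≈ᶜ-refl ↭-refl
no-typable (vr W) = vr-typable W []
no-typable (ne U) = ne-typable U (mul [])
no-typable (W [\ U ]) with N ∷ _ , Φ ← no-typable W =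
  _ , es Φ (proj₂ (ne-typable U (mul N))) ≈ᶜ-refl

-- Every constructor counted in the term lies outside abstractions, hence is typed by exactly one
-- rule counting 1.
size-≤-sz : (Φ : Γ ⊢ t ∶ σ) → ∣ t ∣ ≤ sz Φ
size-≤-sz (ax _ _ _)  = z≤n
size-≤-sz (es Φ Ψ _)  = s≤s (+-mono-≤ (size-≤-sz Φ) (size-≤-sz Ψ))
size-≤-sz (abs _ _ _) = z≤n
size-≤-sz (app Φ Ψ _) = s≤s (+-mono-≤ (size-≤-sz Φ) (size-≤-sz Ψ))

-- The bound `s` makes the recursion structural: each step lowers `sz` strictly and so uses up one
-- unit of `s`.
normalisation : ∀ s (Φ : Γ ⊢ t ∶ σ) → sz Φ ≤ s →
  ∃[ p ] ∃[ b ] ∃[ e ] (No p × t ↠v⟨ b , e ⟩ p × s ≥ b + e + ∣ p ∣)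
normalisation {t = t} s Φ l with progress t
... | normal N = t , 0 , 0 , N , done , ≤-trans (size-≤-sz Φ) l
... | dB-step S with subject-reduction (dB⇒v S) Φ | s
...   | Φ′ , l′ | zero  with () ← ≤-trans l′ l
...   | Φ′ , l′ | suc s =
  let p , b , e , N , T , l″ = normalisation s Φ′ (s≤s⁻¹ (≤-trans l′ l))
  in p , suc b , e , N , step-dB S T , s≤s l″
normalisation {t = t} s Φ l | sv-step S with subject-reduction (sv⇒v S) Φ | s
...   | Φ′ , l′ | zero  with () ← ≤-trans l′ l
...   | Φ′ , l′ | suc s =
  let p , b , e , N , T , l″ = normalisation s Φ′ (s≤s⁻¹ (≤-trans l′ l))
  in p , b , suc e , N , step-sv S T ,
     ≤-trans (≤-reflexive (cong (_+ ∣ p ∣) (+-suc b e))) (s≤s l″)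

-- Counted and uncounted reduction sequences

↠⇒Star : t ↠v⟨ b , d ⟩ u → Star _⟶v_ t u
↠⇒Star done          = ε
↠⇒Star (step-dB S T) = dB⇒v S ◅ ↠⇒Star T
↠⇒Star (step-sv S T) = sv⇒v S ◅ ↠⇒Star T

expansion : Star _⟶v_ t u → Γ ⊢ u ∶ σ → Γ ⊢ t ∶ σ
expansion ε        Φ = Φ
expansion (S ◅ Ss) Φ = subject-expansion S (expansion Ss Φ)

theorem4p24 : ∀ {n} (t : Term n) →
    (Typable t ⇔ Normalising t)
    × (∀ {Γ τ} (Φ : Γ ⊢ t ∶ τ) →
    ∃[ p ] ∃[ b ] ∃[ e ]
    (No p × t ↠v⟨ b , e ⟩ p × sz Φ ≥ b + e + ∣ p ∣))
theorem4p24 t = mk⇔ typable⇒normalising normalising⇒typable , λ Φ → normalisation (sz Φ) Φ ≤-refl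
  where
  typable⇒normalising : Typable t → Normalising t
  typable⇒normalising (_ , _ , Φ) =
    let p , _ , _ , N , T , _ = normalisation (sz Φ) Φ ≤-refl
    in p , ↠⇒Star T , λ _ → no-irreducible N

  normalising⇒typable : Normalising t → Typable t
  normalising⇒typable (_ , Ss , irr) =
    let _ , Φ = no-typable (irreducible-no irr) in _ , _ , expansion Ss Φ
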